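{- For all non-negative integers $n,t$ with $n\equiv 1\pmod 3$ and $t\le n$, we have $$v_3(h(n,t))\ge\begin{cases}0&\text{if } t\equiv 1\pmod 3,\\ 1&\text{if } t\not\equiv 1\pmod 3.\end{cases}$$
   Context: $v_3$ denotes the $3$-adic valuation (on nonzero rational numbers). For integers $n\ge t\ge 0$, define $$h(n,t)=\frac{(2n+1)\,(n+t)!}{(2t+1)!\,(n-t)!}.$$ -}

module Defs where

open import Data.Nat.Base using (ℕ; zero; suc; _+_; _*_; _∸_; _^_; _!; _≤_; _<_; z≤n; s≤s; NonZero; NonTrivial; nonTrivial⇒n>1)
open import Data.Nat.Properties using (_!≢0; _!*_!≢0; m*n≢0; +-comm; ≤-trans; <⇒≤; ≤-refl; *-monoˡ-≤; +-mono-≤; +-identityʳ; m≤n⇒m<n∨m≡n; module ≤-Reasoning)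
open import Data.Nat.Divisibility using (_∣_; _∣?_; ∣⇒≤; 1∣_)
open import Data.Integer.Base as ℤ using (ℤ; +_)
open import Data.Rational.Base as ℚ using (ℚ; ↥_; ↧ₙ_)
open import Data.Rational.Properties using (normalize-pos; pos⇒nonZero)
open import Data.Sum.Base using (inj₁; inj₂)
open import Relation.Nullary using (yes; no; contradiction)
open import Relation.Binary.PropositionalEquality using (refl; sym; cong)

-- The largest k ≤ b with p ^ k ∣ n.
maxExponent≤ : (b p n : ℕ) → ℕ
maxExponent≤ zero    p n = 0
maxExponent≤ (suc b) p n with p ^ suc b ∣? n
... | yes _ = suc b
... | no  _ = maxExponent≤ b p n

-- For p ≥ 2 and n ≠ 0, p ^ k ∣ n forces k < p ^ k ≤ n, so the search bound n
-- loses nothing: see vℕ-∣ and vℕ-max.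
vℕ : (p n : ℕ) → .{{NonTrivial p}} → .{{NonZero n}} → ℕ
vℕ p n = maxExponent≤ n p n

∣↥∣-nonZero : (q : ℚ) → .{{ℚ.NonZero q}} → NonZero ℤ.∣ ↥ q ∣
∣↥∣-nonZero (ℚ.mkℚ ℤ.+[1+ _ ] _ _) = _
∣↥∣-nonZero (ℚ.mkℚ ℤ.-[1+ _ ] _ _) = _

v : (p : ℕ) → .{{NonTrivial p}} → (q : ℚ) → .{{ℚ.NonZero q}} → ℤ
v p q = + vℕ p ℤ.∣ ↥ q ∣ ℤ.- + vℕ p (↧ₙ q)
  where instance _ = ∣↥∣-nonZero q

-- Meaningful for t ≤ n, where n ∸ t is the true difference.
h : (n t : ℕ) → ℚ
h n t = (+ ((2 * n + 1) * (n + t) !)) ℚ./ ((2 * t + 1) ! * (n ∸ t) !)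
  where instance _ = (2 * t + 1) !* (n ∸ t) !≢0

h-nonZero : ∀ n t → ℚ.NonZero (h n t)
h-nonZero n t = pos⇒nonZero (h n t) {{normalize-pos num den {{den≢0}} {{num≢0}}}}
  where
  num = (2 * n + 1) * (n + t) !
  den = (2 * t + 1) ! * (n ∸ t) !
  m+1≢0 : ∀ m → NonZero (m + 1)
  m+1≢0 m rewrite +-comm m 1 = _
  den≢0 : NonZero den
  den≢0 = (2 * t + 1) !* (n ∸ t) !≢0
  num≢0 : NonZero num
  num≢0 = m*n≢0 _ _ {{m+1≢0 (2 * n)}} {{(n + t) !≢0}}

private
  maxExponent≤-∣ : ∀ b p n → p ^ maxExponent≤ b p n ∣ n
  maxExponent≤-∣ zero    p n = 1∣ n
  maxExponent≤-∣ (suc b) p n with p ^ suc b ∣? n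
  ... | yes d = d
  ... | no  _ = maxExponent≤-∣ b p n

  maxExponent≤-max : ∀ b p n {k} → k ≤ b → p ^ k ∣ n → k ≤ maxExponent≤ b p n
  maxExponent≤-max zero    p n k≤b d = k≤b
  maxExponent≤-max (suc b) p n k≤b d with p ^ suc b ∣? n
  ... | yes _ = k≤b
  ... | no ¬d with m≤n⇒m<n∨m≡n k≤b
  ...   | inj₁ (s≤s k≤b′) = maxExponent≤-max b p n k≤b′ d
  ...   | inj₂ refl       = contradiction d ¬d

  k<p^k : ∀ p k → 1 < p → k < p ^ k
  k<p^k p zero    1<p = ≤-refl
  k<p^k p (suc k) 1<p = begin
    2 + k                   ≤⟨ +-mono-≤ (≤-trans (s≤s z≤n) ih) ih ⟩
    p ^ k + p ^ k           ≡⟨ cong (λ m → p ^ k + m) (sym (+-identityʳ (p ^ k))) ⟩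
    2 * p ^ k               ≤⟨ *-monoˡ-≤ (p ^ k) 1<p ⟩
    p * p ^ k               ∎
    where
    open ≤-Reasoning
    ih = k<p^k p k 1<p

vℕ-∣ : ∀ p n .{{_ : NonTrivial p}} .{{_ : NonZero n}} → p ^ vℕ p n ∣ n
vℕ-∣ p n = maxExponent≤-∣ n p n

vℕ-max : ∀ p n .{{_ : NonTrivial p}} .{{_ : NonZero n}} {k} → p ^ k ∣ n → k ≤ vℕ p n
vℕ-max p n {k} d =
  maxExponent≤-max n p n (<⇒≤ (≤-trans (k<p^k p k (nonTrivial⇒n>1 p)) (∣⇒≤ d))) d

{-# OPTIONS --safe #-}

-- With n = t + d one has 2n + 1 = (2t + 1 + d) + d, so the numerator
-- (2n + 1) (2t + d)! equals (2t + 1 + d)! + d (2t + d)!; both summands are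
-- multiples of (2t + 1)! d!, hence h(n,t) is an integer. Moreover
-- (2t + 1) h(n,t) = (2n + 1) C(n + t, 2t), and 3 ∣ 2m + 1 iff m ≡ 1 (mod 3), so for
-- n ≡ 1 and t ≢ 1 the factor 3 of the right-hand side must divide h(n,t).
module Submission where

open import Defs
open import Data.Nat.Base using (ℕ; zero; suc; _+_; _*_; _∸_; _^_; _!; _/_; _≤_; s≤s; _%_; NonZero; NonTrivial; nonTrivial⇒≢1)
open import Data.Nat.Properties using (+-comm; *-comm; *-assoc; *-identityʳ; *-cancelʳ-≡; m≤m+n; m+n∸m≡n; m≤n⇒∃[o]m+o≡n; _!*_!≢0)
open import Data.Nat.Combinatorics using (k![n∸k]!∣n!)
open import Data.Nat.Coprimality as Coprime using (1-coprimeTo)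
open import Data.Nat.Divisibility using (_∣_; divides; _∣?_; 1∣_; ∣-trans; ∣m∣n⇒∣m+n; *-monoʳ-∣; ∣1⇒≡1; m%n≡0⇒n∣m; n∣m⇒m%n≡0)
open import Data.Nat.DivMod using (m≡m%n+[m/n]*n; [m+kn]%n≡m%n; m%n<n)
open import Data.Nat.Primality using (prime?; euclidsLemma)
open import Data.Nat.Tactic.RingSolver using (solve-∀)
open import Data.Integer.Base as ℤ using (+_)
open import Data.Integer.Properties as ℤ using ()
open import Data.Rational.Base as ℚ using (ℚ; mkℚ)
open import Data.Rational.Properties using (fromℚᵘ-toℚᵘ; fromℚᵘ-cong)
open import Data.Rational.Unnormalised.Base using (mkℚᵘ; *≡*)
open import Data.Product.Base using (_×_; _,_)
open import Data.Sum.Base using (inj₁; inj₂)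
open import Relation.Nullary using (yes; no; contradiction)
open import Relation.Nullary.Decidable using (from-yes)
open import Relation.Binary.PropositionalEquality using (_≡_; _≢_; refl; sym; trans; cong; cong₂; subst; subst₂; module ≡-Reasoning)

-- Built with `mkℚ` directly, so that numerator `m` and denominator 1 are visible to computation and
-- `v` unfolds without normalising a fraction.
fromℕ : ℕ → ℚ
fromℕ m = mkℚ (+ m) 0 (Coprime.sym (1-coprimeTo m))

m≡k*d⇒m/d≡k : ∀ m d k .{{_ : NonZero d}} → m ≡ k * d → (+ m) ℚ./ d ≡ fromℕ k
m≡k*d⇒m/d≡k m (suc d) k m≡k*d = trans
  -- By definition `+ m / suc d` is `fromℚᵘ` of the unreduced fraction, so cross-multiplying
  -- suffices.
  (fromℚᵘ-cong {mkℚᵘ (+ m) d} {mkℚᵘ (+ k) 0} (*≡* (begin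
    + m ℤ.* + 1     ≡⟨ ℤ.*-identityʳ (+ m) ⟩
    + m             ≡⟨ cong +_ m≡k*d ⟩
    + (k * suc d)   ≡⟨ ℤ.pos-* k (suc d) ⟩
    + k ℤ.* + suc d ∎)))
  (fromℚᵘ-toℚᵘ (fromℕ k))
  where open ≡-Reasoning

vℕ-1 : ∀ p .{{_ : NonTrivial p}} → vℕ p 1 ≡ 0
-- The search bound is 1, so the only exponent tested is 1.
vℕ-1 p with p ^ 1 ∣? 1
... | yes d = contradiction (trans (sym (*-identityʳ p)) (∣1⇒≡1 d)) (nonTrivial⇒≢1 {p})
... | no  _ = refl

v-fromℕ-≥ : ∀ p .{{_ : NonTrivial p}} m .{{_ : ℚ.NonZero (fromℕ m)}} {k} →
            p ^ k ∣ m → v p (fromℕ m) ℤ.≥ + k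
v-fromℕ-≥ p m@(suc _) {k} p^k∣m = subst (ℤ._≥ + k)
  (sym (trans (cong (λ x → + vℕ p m ℤ.- + x) (vℕ-1 p)) (ℤ.+-identityʳ (+ vℕ p m))))
  (ℤ.+≤+ (vℕ-max p m p^k∣m))

-- Keeping `q` a variable lets `refl` replace it inside its nonzero instance as well, with no
-- transport.
v-≥ : ∀ p .{{_ : NonTrivial p}} q .{{_ : ℚ.NonZero q}} {m k} →
      q ≡ fromℕ m → p ^ k ∣ m → v p q ℤ.≥ + k
v-≥ p .(fromℕ m) {m} refl p^k∣m = v-fromℕ-≥ p m p^k∣m

m!n!∣[m+n]! : ∀ m n → m ! * n ! ∣ (m + n) !
m!n!∣[m+n]! m n =
  subst (λ k → m ! * k ! ∣ (m + n) !) (m+n∸m≡n m n) (k![n∸k]!∣n! (m≤m+n m n))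

[1+a]!d!∣[1+a+2d][a+d]! : ∀ a d → suc a ! * d ! ∣ (suc a + d + d) * (a + d) !
[1+a]!d!∣[1+a+2d][a+d]! a d =
  -- `(suc a + d) !` unfolds to `(suc a + d) * (a + d) !`, the first summand of `split`.
  subst (suc a ! * d ! ∣_) (split a d ((a + d) !))
    (∣m∣n⇒∣m+n (m!n!∣[m+n]! (suc a) d) (second d))
  where
  split : ∀ a d x → (suc a + d) * x + d * x ≡ (suc a + d + d) * x
  split = solve-∀

  swap : ∀ x e y → suc e * (x * y) ≡ x * (suc e * y)
  swap = solve-∀

  shift : ∀ a e → suc a + e ≡ a + suc e
  shift = solve-∀

  second : ∀ d → suc a ! * d ! ∣ d * (a + d) !
  second zero    = divides 0 refl
  -- For d = e + 1, (a + d)! = (a + 1 + e)! is a multiple of (a + 1)! e!, and the factor d turns e!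
  -- into d!.
  second (suc e) = subst₂ _∣_ (swap (suc a !) e (e !)) (cong (λ x → suc e * x !) (shift a e))
    (*-monoʳ-∣ (suc e) (m!n!∣[m+n]! (suc a) e))

[2m+1]%3 : ∀ m → (2 * m + 1) % 3 ≡ (2 * (m % 3) + 1) % 3
[2m+1]%3 m = begin
  (2 * m + 1) % 3                       ≡⟨ cong (λ x → (2 * x + 1) % 3) (m≡m%n+[m/n]*n m 3) ⟩
  (2 * (m % 3 + m / 3 * 3) + 1) % 3     ≡⟨ cong (_% 3) (regroup (m % 3) (m / 3)) ⟩
  (2 * (m % 3) + 1 + 2 * (m / 3) * 3) % 3 ≡⟨ [m+kn]%n≡m%n (2 * (m % 3) + 1) (2 * (m / 3)) 3 ⟩
  (2 * (m % 3) + 1) % 3                 ∎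
  where
  open ≡-Reasoning
  regroup : ∀ r q → 2 * (r + q * 3) + 1 ≡ 2 * r + 1 + 2 * q * 3
  regroup = solve-∀

m%3≡1⇒3∣2m+1 : ∀ m → m % 3 ≡ 1 → 3 ∣ 2 * m + 1
m%3≡1⇒3∣2m+1 m m%3≡1 = m%n≡0⇒n∣m (2 * m + 1) 3
  (trans ([2m+1]%3 m) (cong (λ r → (2 * r + 1) % 3) m%3≡1))

3∣2m+1⇒m%3≡1 : ∀ m → 3 ∣ 2 * m + 1 → m % 3 ≡ 1
3∣2m+1⇒m%3≡1 m 3∣2m+1 =
  residue (m % 3) (m%n<n m 3) (trans (sym ([2m+1]%3 m)) (n∣m⇒m%n≡0 (2 * m + 1) 3 3∣2m+1))
  where
  residue : ∀ r → suc r ≤ 3 → (2 * r + 1) % 3 ≡ 0 → r ≡ 1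
  -- For residues 0 and 2 the last hypothesis computes to `1 ≡ 0` and `2 ≡ 0`, which are absurd.
  residue 1 _ _ = refl
  residue (suc (suc (suc _))) (s≤s (s≤s (s≤s ()))) _

h-num : ℕ → ℕ → ℕ
h-num n t = (2 * n + 1) * (n + t) !

h-den : ℕ → ℕ → ℕ
h-den n t = (2 * t + 1) ! * (n ∸ t) !

2t+d≡t+d+t : ∀ t d → 2 * t + d ≡ t + d + t
2t+d≡t+d+t = solve-∀

h-den∣h-num : ∀ {n t} → t ≤ n → h-den n t ∣ h-num n t
h-den∣h-num {t = t} t≤n with d , refl ← m≤n⇒∃[o]m+o≡n t≤n =
  subst₂ _∣_
    (cong₂ (λ x y → x ! * y !) (+-comm 1 (2 * t)) (sym (m+n∸m≡n t d)))
    (cong₂ (λ x y → x * y !) (2t+1+2d≡2[t+d]+1 t d) (2t+d≡t+d+t t d))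
    ([1+a]!d!∣[1+a+2d][a+d]! (2 * t) d)
  where
  2t+1+2d≡2[t+d]+1 : ∀ t d → suc (2 * t) + d + d ≡ 2 * (t + d) + 1
  2t+1+2d≡2[t+d]+1 = solve-∀

-- The quotient is the binomial coefficient C(n + t, 2t), because (n + t) - 2t = n - t.
[2t]![n∸t]!∣[n+t]! : ∀ {n t} → t ≤ n → (2 * t) ! * (n ∸ t) ! ∣ (n + t) !
[2t]![n∸t]!∣[n+t]! {t = t} t≤n with d , refl ← m≤n⇒∃[o]m+o≡n t≤n =
  subst₂ _∣_
    (cong (λ x → (2 * t) ! * x !) (sym (m+n∸m≡n t d)))
    (cong _! (2t+d≡t+d+t t d))
    (m!n!∣[m+n]! (2 * t) d)

-- Here k is the integer h(n,t) and the cofactor `c` is C(n + t, 2t). Since (2t + 1) `D` is the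
-- denominator of h(n,t), both sides agree after multiplication by `D`, which is then cancelled.
2n+1∣k*[2t+1] : ∀ {n t} k → t ≤ n → h-num n t ≡ k * h-den n t →
             2 * n + 1 ∣ k * (2 * t + 1)
2n+1∣k*[2t+1] {n} {t} k t≤n num≡k*den
  with divides c [n+t]!≡c*D ← [2t]![n∸t]!∣[n+t]! t≤n =
  divides c (*-cancelʳ-≡ (k * (2 * t + 1)) (c * (2 * n + 1)) D {{(2 * t) !* (n ∸ t) !≢0}} (begin
    k * (2 * t + 1) * D                      ≡⟨ pull k (2 * t) ((2 * t) !) ((n ∸ t) !) ⟩
    k * (suc (2 * t) ! * (n ∸ t) !)          ≡⟨ cong (λ x → k * (x ! * (n ∸ t) !)) (+-comm 1 (2 * t)) ⟩
    k * h-den n t                            ≡⟨ num≡k*den ⟨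
    (2 * n + 1) * (n + t) !                  ≡⟨ cong ((2 * n + 1) *_) [n+t]!≡c*D ⟩
    (2 * n + 1) * (c * D)                    ≡⟨ *-assoc (2 * n + 1) c D ⟨
    (2 * n + 1) * c * D                      ≡⟨ cong (_* D) (*-comm (2 * n + 1) c) ⟩
    c * (2 * n + 1) * D                      ∎))
  where
  open ≡-Reasoning
  D = (2 * t) ! * (n ∸ t) !
  pull : ∀ k a x y → k * (a + 1) * (x * y) ≡ k * (suc a * x * y)
  pull = solve-∀

lemma3p2 : (n t : ℕ) → n % 3 ≡ 1 → t ≤ n →
    (t % 3 ≡ 1 → v 3 (h n t) {{h-nonZero n t}} ℤ.≥ + 0) ×
    (t % 3 ≢ 1 → v 3 (h n t) {{h-nonZero n t}} ℤ.≥ + 1)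
lemma3p2 n t n%3≡1 t≤n with divides k num≡k*den ← h-den∣h-num t≤n =
  (λ _ → v-≥ 3 (h n t) {{h-nonZero n t}} {k} {0} h≡k (1∣ k)) ,
  (λ t%3≢1 → v-≥ 3 (h n t) {{h-nonZero n t}} {k} {1} h≡k (3∣k t%3≢1))
  where
  h≡k : h n t ≡ fromℕ k
  h≡k = m≡k*d⇒m/d≡k (h-num n t) (h-den n t) k {{(2 * t + 1) !* (n ∸ t) !≢0}} num≡k*den

  3∣k : t % 3 ≢ 1 → 3 ∣ k
  -- The chain is 3 ∣ 2n + 1 ∣ k (2t + 1), and 3 is prime.
  3∣k t%3≢1 with euclidsLemma k (2 * t + 1) (from-yes (prime? 3))
                   (∣-trans (m%3≡1⇒3∣2m+1 n n%3≡1) (2n+1∣k*[2t+1] k t≤n num≡k*den))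
  ... | inj₁ 3∣k    = 3∣k
  ... | inj₂ 3∣2t+1 = contradiction (3∣2m+1⇒m%3≡1 t 3∣2t+1) t%3≢1
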